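{- Let $V$ be a set of $N\geq3$ truth values with a partial order $\leq$ having $0$ as least and $1$ as greatest element, let $\models_{\leq}$ be the associated order-theoretic truth-relation, and assume the semantics is at least atomic expressive. Then $\models_{\leq}$ admits no G-negation and no G-conditional. Moreover, it admits a G-conjunction and a G-disjunction if and only if it is total, i.e. any two truth values other than $0,1$ are comparable under $\leq$.
   Context: $\gamma\models_{\leq}\delta$ iff ($\exists x\in\gamma,\exists y\in\delta: x\leq y$) or $0\in\gamma$ or $1\in\delta$. Semantics: valuations mapping atoms to $V$, connectives interpreted by fixed truth functions, extended compositionally, every assignment of values to finitely many distinct atoms realized. Atomic expressive: for every $\gamma\subseteq V$ some set of formulas $\Gamma$ and valuation $v$ have $v(\Gamma)=\gamma$. $\Gamma\vdash\Delta$ iff $v(\Gamma)\models_{\leq}v(\Delta)$ for all $v$; $\Gamma,A=\Gamma\cup\{A\}$. Admitting a G-connective means some truth function makes a connective satisfy, for all $\Gamma,\Delta,A,B$: G-conjunction: $\Gamma,A\wedge B\vdash\Delta$ iff $\Gamma,A,B\vdash\Delta$; $\Gamma\vdash A\wedge B,\Delta$ iff ($\Gamma\vdash A,\Delta$ and $\Gamma\vdash B,\Delta$). G-disjunction: $\Gamma\vdash A\vee B,\Delta$ iff $\Gamma\vdash A,B,\Delta$; $\Gamma,A\vee B\vdash\Delta$ iff ($\Gamma,A\vdash\Delta$ and $\Gamma,B\vdash\Delta$). G-negation: $\Gamma,\neg A\vdash\Delta$ iff $\Gamma\vdash A,\Delta$; $\Gamma\vdash\neg A,\Delta$ iff $\Gamma,A\vdash\Delta$.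 G-conditional: $\Gamma\vdash A\to B,\Delta$ iff $\Gamma,A\vdash B,\Delta$; $\Gamma,A\to B\vdash\Delta$ iff ($\Gamma\vdash A,\Delta$ and $\Gamma,B\vdash\Delta$). -}

module Defs where

open import Data.Maybe.Base using (Maybe; just; nothing)
open import Data.Fin.Base using (Fin)
open import Data.Nat.Base using (ℕ)
open import Data.Product using (∃; ∃₂; _×_; _,_)
open import Data.Sum.Base using (_⊎_)
open import Data.Vec.Base using (Vec; []; _∷_)
open import Function.Bundles using (_↣_; _⇔_; Injection)
open import Level using (0ℓ)
open import Relation.Binary.Core using (Rel)
open import Relation.Binary.PropositionalEquality using (_≡_; _≢_)
open import Relation.Unary using (Pred; _∈_; _∪_; _≐_; ｛_｝)

TruthFunction : Set → ℕ → Set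
TruthFunction V n = Vec V n → V

TruthRelation : Set → Set₁
TruthRelation V = Rel (Pred V 0ℓ) 0ℓ

module _ {V : Set} (_≤_ : Rel V 0ℓ) (𝟘 𝟙 : V) where

  OrderTruthRelation : TruthRelation V
  OrderTruthRelation γ δ =
    (∃₂ λ x y → x ∈ γ × y ∈ δ × x ≤ y) ⊎ 𝟘 ∈ γ ⊎ 𝟙 ∈ δ

  TotalOffBounds : Set
  TotalOffBounds = ∀ x y → x ≢ 𝟘 → x ≢ 𝟙 → y ≢ 𝟘 → y ≢ 𝟙 → x ≤ y ⊎ y ≤ x

-- The valuations need not be all functions from atoms to V: they are the
-- admissible ones, and every finite assignment extends to an admissible one.
record Semantics (V : Set) : Set₁ where
  field
    Atom       : Set
    Connective : Set
    arity      : Connective → ℕ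
    interpret  : (c : Connective) → TruthFunction V (arity c)
    Admissible : Pred (Atom → V) 0ℓ
    realize    : ∀ {n} (p : Fin n ↣ Atom) (a : Fin n → V) →
                 ∃ λ v → Admissible v × (∀ i → v (Injection.to p i) ≡ a i)

  data Formula : Set where
    atom : Atom → Formula
    node : (c : Connective) → Vec Formula (arity c) → Formula

  mutual
    eval : (Atom → V) → Formula → V
    eval v (atom p)    = v p
    eval v (node c As) = interpret c (evals v As)

    -- `map (eval v)`, unfolded for the termination checker.
    evals : ∀ {n} → (Atom → V) → Vec Formula n → Vec V n
    evals v []       = []
    evals v (A ∷ As) = eval v A ∷ evals v As

  FormulaSet : Set₁
  FormulaSet = Pred Formula 0ℓ

  infixl 5 _▸_
  _▸_ : FormulaSet → Formula → FormulaSet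
  Γ ▸ A = Γ ∪ ｛ A ｝

  image : (Atom → V) → FormulaSet → Pred V 0ℓ
  image v Γ x = ∃ λ A → A ∈ Γ × eval v A ≡ x

  AtomicExpressive : Set₁
  AtomicExpressive =
    ∀ (γ : Pred V 0ℓ) → ∃₂ λ Γ v → Admissible v × image v Γ ≐ γ

  Consequence : TruthRelation V → Rel FormulaSet 0ℓ
  Consequence _⊨_ Γ Δ = ∀ v → Admissible v → image v Γ ⊨ image v Δ

  module GRules (_⊨_ : TruthRelation V) where

    infix 4 _⊢_
    _⊢_ : Rel FormulaSet 0ℓ
    _⊢_ = Consequence _⊨_

    IsGNegation : (Formula → Formula) → Set₁
    IsGNegation neg = ∀ Γ Δ A →
      (Γ ▸ neg A ⊢ Δ ⇔ Γ ⊢ Δ ▸ A) ×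
      (Γ ⊢ Δ ▸ neg A ⇔ Γ ▸ A ⊢ Δ)

    IsGConjunction : (Formula → Formula → Formula) → Set₁
    IsGConjunction _∧_ = ∀ Γ Δ A B →
      (Γ ▸ (A ∧ B) ⊢ Δ ⇔ Γ ▸ A ▸ B ⊢ Δ) ×
      (Γ ⊢ Δ ▸ (A ∧ B) ⇔ (Γ ⊢ Δ ▸ A × Γ ⊢ Δ ▸ B))

    IsGDisjunction : (Formula → Formula → Formula) → Set₁
    IsGDisjunction _∨_ = ∀ Γ Δ A B →
      (Γ ⊢ Δ ▸ (A ∨ B) ⇔ Γ ⊢ Δ ▸ A ▸ B) ×
      (Γ ▸ (A ∨ B) ⊢ Δ ⇔ (Γ ▸ A ⊢ Δ × Γ ▸ B ⊢ Δ))

    IsGConditional : (Formula → Formula → Formula) → Set₁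
    IsGConditional _⊃_ = ∀ Γ Δ A B →
      (Γ ⊢ Δ ▸ (A ⊃ B) ⇔ Γ ▸ A ⊢ Δ ▸ B) ×
      (Γ ▸ (A ⊃ B) ⊢ Δ ⇔ (Γ ⊢ Δ ▸ A × Γ ▸ B ⊢ Δ))

open Semantics using (AtomicExpressive) public

-- Same atoms and valuations, with one further connective `nothing`
-- interpreted by f; formulas are those of the enlarged language.
extend : ∀ {V} → Semantics V → (n : ℕ) → TruthFunction V n → Semantics V
extend {V} S n f = record
  { Atom       = Atom
  ; Connective = Maybe Connective
  ; arity      = arity⁺
  ; interpret  = interpret⁺
  ; Admissible = Admissible
  ; realize    = realize
  }
  where
  open Semantics S

  arity⁺ : Maybe Connective → ℕ
  arity⁺ nothing  = n
  arity⁺ (just c) = arity c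

  interpret⁺ : (c : Maybe Connective) → TruthFunction V (arity⁺ c)
  interpret⁺ nothing  = f
  interpret⁺ (just c) = interpret c

module _ {V : Set} (S : Semantics V) (_⊨_ : TruthRelation V) where

  AdmitsUnary : (∀ (S⁺ : Semantics V) →
                 (Semantics.Formula S⁺ → Semantics.Formula S⁺) → Set₁) → Set₁
  AdmitsUnary P = ∃ λ f → P (extend S 1 f) λ A → Semantics.node nothing (A ∷ [])

  AdmitsBinary : (∀ (S⁺ : Semantics V) →
                  (Semantics.Formula S⁺ → Semantics.Formula S⁺ →
                   Semantics.Formula S⁺) → Set₁) → Set₁
  AdmitsBinary P =
    ∃ λ f → P (extend S 2 f) λ A B → Semantics.node nothing (A ∷ B ∷ [])

  AdmitsGNegation AdmitsGConjunction AdmitsGDisjunction AdmitsGConditional : Set₁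
  AdmitsGNegation    = AdmitsUnary  λ S⁺ → Semantics.GRules.IsGNegation    S⁺ _⊨_
  AdmitsGConjunction = AdmitsBinary λ S⁺ → Semantics.GRules.IsGConjunction S⁺ _⊨_
  AdmitsGDisjunction = AdmitsBinary λ S⁺ → Semantics.GRules.IsGDisjunction S⁺ _⊨_
  AdmitsGConditional = AdmitsBinary λ S⁺ → Semantics.GRules.IsGConditional S⁺ _⊨_

{-# OPTIONS --safe #-}
module Submission where

open import Defs
import Algebra.Construct.NaturalChoice.Max as Max
import Algebra.Construct.NaturalChoice.Min as Min
open import Data.Empty using (⊥)
open import Data.Fin.Base using (Fin; zero; suc)
open import Data.Fin.Properties using (inj⇒≟)
open import Data.Maybe.Base using (just)
open import Data.Nat.Base using (ℕ; s≤s) renaming (_≤_ to _≤ℕ_)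
open import Data.Product using (∃; _×_; _,_; proj₁; proj₂)
open import Data.Sum.Base using (_⊎_; inj₁; inj₂)
open import Data.Vec.Base using (Vec; []; _∷_)
open import Function.Base using (_∘_; id)
open import Function.Bundles using (Equivalence; Inverse; mk⇔; _↔_; _⇔_)
open import Function.Properties.Inverse using (↔⇒↣)
open import Level using (0ℓ)
open import Relation.Binary.Bundles using (TotalOrder)
open import Relation.Binary.Core using (Rel)
open import Relation.Binary.Definitions
  using (DecidableEquality; Maximum; Minimum; Total)
open import Relation.Binary.PropositionalEquality
  using (_≡_; _≢_; refl; sym; trans; cong; cong₂; subst)
open import Relation.Binary.Structures using (IsPartialOrder)
open import Relation.Nullary using (¬_; contradiction; yes; no)
open import Relation.Unary using (_∈_; _⊆_; ∅)

open Equivalence using (from)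

-- Atomic expressiveness for γ = V yields one admissible valuation v under which
-- every truth value is the value of a formula. The G-rules and reflexivity of ⊢
-- give A, ¬A ⊢ and ⊢ A, ¬A; at v, with A of a value h other than 0 and 1, they
-- force ¬h to be both 0 and 1. Likewise ⊢ A → B, A forces h → 0 to be 1, which
-- refutes A → B, A ⊢ B. From A, B ⊢ A ∧ B and A ∧ B ⊢ A, B separately, the value
-- of A ∧ B is a lower bound of x and y above one of them, so x and y are
-- comparable. Conversely, on a chain minimum and maximum obey the G-rules, being
-- bounds that coincide with one of their arguments.

-- Two indices exclude at most two of 0, 1 and 2; the least one left is returned.
avoid-two : ∀ {n} → 3 ≤ℕ n → (i j : Fin n) → ∃ λ k → k ≢ i × k ≢ j
avoid-two (s≤s (s≤s (s≤s _))) zero          zero          = suc zero , (λ ()) , λ ()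
avoid-two (s≤s (s≤s (s≤s _))) zero          (suc zero)    = suc (suc zero) , (λ ()) , λ ()
avoid-two (s≤s (s≤s (s≤s _))) zero          (suc (suc _)) = suc zero , (λ ()) , λ ()
avoid-two (s≤s (s≤s (s≤s _))) (suc zero)    zero          = suc (suc zero) , (λ ()) , λ ()
avoid-two (s≤s (s≤s (s≤s _))) (suc (suc _)) zero          = suc zero , (λ ()) , λ ()
avoid-two (s≤s (s≤s (s≤s _))) (suc _)       (suc _)       = zero , (λ ()) , λ ()

-- Valuations that reach every truth value.

HasGenericValuation : ∀ {V} → Semantics V → Set
HasGenericValuation S =
  ∃ λ v → Semantics.Admissible S v × ∀ x → ∃ λ A → Semantics.eval S v A ≡ x

-- Atomic expressiveness enters the proof only in this form, which speaks of single formulas and so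
-- passes easily to a larger language. The predicate `x ≡ x` stands for all of `V`.
atomicExpressive⇒generic : ∀ {V} (S : Semantics V) →
                           AtomicExpressive S → HasGenericValuation S
atomicExpressive⇒generic S expressive with expressive (λ x → x ≡ x)
... | Γ , v , adm , _ , covers = v , adm , λ x →
  let A , _ , eq = covers {x} refl in A , eq

module _ {V : Set} (S : Semantics V) (n : ℕ) (f : TruthFunction V n) where

  private
    module S  = Semantics S
    module S⁺ = Semantics (extend S n f)

  mutual
    -- The two languages have separate datatypes of formulas. Formulas of `S` that take prescribed
    -- values must be translated before the rules of a new connective apply to them.
    embed : S.Formula → S⁺.Formula
    embed (S.atom p)    = S⁺.atom p
    embed (S.node c As) = S⁺.node (just c) (embeds As)

    embeds : ∀ {k} → Vec S.Formula k → Vec S⁺.Formula k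
    embeds []       = []
    embeds (A ∷ As) = embed A ∷ embeds As

  mutual
    eval-embed : ∀ v A → S⁺.eval v (embed A) ≡ S.eval v A
    eval-embed v (S.atom p)    = refl
    eval-embed v (S.node c As) = cong (S.interpret c) (evals-embeds v As)

    evals-embeds : ∀ {k} v (As : Vec S.Formula k) →
                   S⁺.evals v (embeds As) ≡ S.evals v As
    evals-embeds v []       = refl
    evals-embeds v (A ∷ As) = cong₂ _∷_ (eval-embed v A) (evals-embeds v As)

  generic-extend : HasGenericValuation S → HasGenericValuation (extend S n f)
  generic-extend (v , adm , onto) = v , adm , λ x →
    let A , eq = onto x in embed A , trans (eval-embed v A) eq

-- Monotonicity of the order-theoretic truth-relation.

module _ {V : Set} {_≤_ : Rel V 0ℓ} (po : IsPartialOrder _≡_ _≤_)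
         {𝟘 𝟙 : V} (𝟘-min : Minimum _≤_ 𝟘) (𝟙-max : Maximum _≤_ 𝟙) where

  private
    module ≤ = IsPartialOrder po
    _⊨_ = OrderTruthRelation _≤_ 𝟘 𝟙

  ≤𝟘⇒≡𝟘 : ∀ {x} → x ≤ 𝟘 → x ≡ 𝟘
  ≤𝟘⇒≡𝟘 x≤𝟘 = ≤.antisym x≤𝟘 (𝟘-min _)

  𝟙≤⇒≡𝟙 : ∀ {x} → 𝟙 ≤ x → x ≡ 𝟙
  𝟙≤⇒≡𝟙 𝟙≤x = ≤.antisym (𝟙-max _) 𝟙≤x

  -- If the bounds coincided, every value would lie below `𝟘` and hence equal it.
  ≢𝟘⇒𝟙≢𝟘 : ∀ {x} → x ≢ 𝟘 → 𝟙 ≢ 𝟘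
  ≢𝟘⇒𝟙≢𝟘 x≢𝟘 𝟙≡𝟘 = x≢𝟘 (≤𝟘⇒≡𝟘 (subst (_ ≤_) 𝟙≡𝟘 (𝟙-max _)))

  module _ (S : Semantics V) where

    open Semantics S
    open GRules _⊨_

    module _ (v : Atom → V) where

      infix 4 _≼ˡ_ _≼ʳ_
      -- The replacements that preserve satisfaction at `v`: premises may go down in value,
      -- conclusions may go up. Weakening is the case of an inclusion.
      _≼ˡ_ _≼ʳ_ : FormulaSet → FormulaSet → Set
      Γ ≼ˡ Γ′ = ∀ {A} → A ∈ Γ → ∃ λ B → B ∈ Γ′ × eval v B ≤ eval v A
      Δ ≼ʳ Δ′ = ∀ {A} → A ∈ Δ → ∃ λ B → B ∈ Δ′ × eval v A ≤ eval v B

      ⊆⇒≼ˡ : ∀ {Γ Γ′} → Γ ⊆ Γ′ → Γ ≼ˡ Γ′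
      ⊆⇒≼ˡ Γ⊆Γ′ A∈Γ = _ , Γ⊆Γ′ A∈Γ , ≤.refl

      ⊆⇒≼ʳ : ∀ {Δ Δ′} → Δ ⊆ Δ′ → Δ ≼ʳ Δ′
      ⊆⇒≼ʳ Δ⊆Δ′ A∈Δ = _ , Δ⊆Δ′ A∈Δ , ≤.refl

      ▸-≼ˡ : ∀ {Γ Γ′ A B} → Γ ⊆ Γ′ → B ∈ Γ′ → eval v B ≤ eval v A → Γ ▸ A ≼ˡ Γ′
      ▸-≼ˡ Γ⊆Γ′ B∈Γ′ B≤A (inj₁ C∈Γ)  = ⊆⇒≼ˡ Γ⊆Γ′ C∈Γ
      ▸-≼ˡ Γ⊆Γ′ B∈Γ′ B≤A (inj₂ refl) = _ , B∈Γ′ , B≤A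

      ▸-≼ʳ : ∀ {Δ Δ′ A B} → Δ ⊆ Δ′ → B ∈ Δ′ → eval v A ≤ eval v B → Δ ▸ A ≼ʳ Δ′
      ▸-≼ʳ Δ⊆Δ′ B∈Δ′ A≤B (inj₁ C∈Δ)  = ⊆⇒≼ʳ Δ⊆Δ′ C∈Δ
      ▸-≼ʳ Δ⊆Δ′ B∈Δ′ A≤B (inj₂ refl) = _ , B∈Δ′ , A≤B

      -- Each clause survives: an inequality by transitivity at both ends, a premise of value `𝟘`
      -- because only `𝟘` lies below it, a conclusion of value `𝟙` dually.
      ⊨-resp-≼ : ∀ {Γ Γ′ Δ Δ′} → Γ ≼ˡ Γ′ → Δ ≼ʳ Δ′ →
                 image v Γ ⊨ image v Δ → image v Γ′ ⊨ image v Δ′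
      ⊨-resp-≼ l r (inj₁ (_ , _ , (A , A∈Γ , refl) , (B , B∈Δ , refl) , A≤B)) =
        let A′ , A′∈ , A′≤A = l A∈Γ
            B′ , B′∈ , B≤B′ = r B∈Δ
        in inj₁ (_ , _ , (A′ , A′∈ , refl) , (B′ , B′∈ , refl) ,
                 ≤.trans A′≤A (≤.trans A≤B B≤B′))
      ⊨-resp-≼ l r (inj₂ (inj₁ (A , A∈Γ , A≡𝟘))) =
        let A′ , A′∈ , A′≤A = l A∈Γ
        in inj₂ (inj₁ (A′ , A′∈ , ≤𝟘⇒≡𝟘 (subst (_ ≤_) A≡𝟘 A′≤A)))
      ⊨-resp-≼ l r (inj₂ (inj₂ (B , B∈Δ , B≡𝟙))) =
        let B′ , B′∈ , B≤B′ = r B∈Δ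
        in inj₂ (inj₂ (B′ , B′∈ , 𝟙≤⇒≡𝟙 (subst (_≤ _) B≡𝟙 B≤B′)))

      ⊨-respˡ-≼ : ∀ {Γ Γ′ Δ} → Γ ≼ˡ Γ′ → image v Γ ⊨ image v Δ → image v Γ′ ⊨ image v Δ
      ⊨-respˡ-≼ l = ⊨-resp-≼ l (⊆⇒≼ʳ id)

      ⊨-respʳ-≼ : ∀ {Γ Δ Δ′} → Δ ≼ʳ Δ′ → image v Γ ⊨ image v Δ → image v Γ ⊨ image v Δ′
      ⊨-respʳ-≼ r = ⊨-resp-≼ (⊆⇒≼ˡ id) r

    shared : ∀ {Γ Δ A} → A ∈ Γ → A ∈ Δ → Γ ⊢ Δ
    shared A∈Γ A∈Δ v _ = inj₁ (_ , _ , (_ , A∈Γ , refl) , (_ , A∈Δ , refl) , ≤.refl)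

    -- Sufficient conditions for G-conjunction and G-disjunction.

    module _ (_∧_ : Formula → Formula → Formula)
             (∧≤ˡ : ∀ v A B → eval v (A ∧ B) ≤ eval v A)
             (∧≤ʳ : ∀ v A B → eval v (A ∧ B) ≤ eval v B)
             (∧-sel : ∀ v A B → eval v (A ∧ B) ≡ eval v A ⊎ eval v (A ∧ B) ≡ eval v B)
             where

      -- Being a lower bound gives `left⁻` and `right⁺`. Coinciding with an argument gives `left⁺`
      -- and `right⁻`; which argument it is may vary with the valuation.
      selective-lower-bound⇒GConjunction : IsGConjunction _∧_
      selective-lower-bound⇒GConjunction Γ Δ A B = mk⇔ left⁺ left⁻ , mk⇔ right⁺ right⁻
        where
        left⁺ : Γ ▸ (A ∧ B) ⊢ Δ → Γ ▸ A ▸ B ⊢ Δ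
        left⁺ d v adm with ∧-sel v A B
        ... | inj₁ eq = ⊨-respˡ-≼ v
          (▸-≼ˡ v (inj₁ ∘ inj₁) (inj₁ (inj₂ refl)) (≤.reflexive (sym eq))) (d v adm)
        ... | inj₂ eq = ⊨-respˡ-≼ v
          (▸-≼ˡ v (inj₁ ∘ inj₁) (inj₂ refl) (≤.reflexive (sym eq))) (d v adm)

        left⁻ : Γ ▸ A ▸ B ⊢ Δ → Γ ▸ (A ∧ B) ⊢ Δ
        left⁻ d v adm = ⊨-respˡ-≼ v l (d v adm)
          where
          l : _≼ˡ_ v (Γ ▸ A ▸ B) (Γ ▸ (A ∧ B))
          l (inj₁ C∈)   = ▸-≼ˡ v inj₁ (inj₂ refl) (∧≤ˡ v A B) C∈
          l (inj₂ refl) = _ , inj₂ refl , ∧≤ʳ v A B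

        right⁺ : Γ ⊢ Δ ▸ (A ∧ B) → Γ ⊢ Δ ▸ A × Γ ⊢ Δ ▸ B
        right⁺ d =
          (λ v adm → ⊨-respʳ-≼ v (▸-≼ʳ v inj₁ (inj₂ refl) (∧≤ˡ v A B)) (d v adm)) ,
          (λ v adm → ⊨-respʳ-≼ v (▸-≼ʳ v inj₁ (inj₂ refl) (∧≤ʳ v A B)) (d v adm))

        right⁻ : Γ ⊢ Δ ▸ A × Γ ⊢ Δ ▸ B → Γ ⊢ Δ ▸ (A ∧ B)
        right⁻ (d , e) v adm with ∧-sel v A B
        ... | inj₁ eq = ⊨-respʳ-≼ v (▸-≼ʳ v inj₁ (inj₂ refl) (≤.reflexive (sym eq))) (d v adm)
        ... | inj₂ eq = ⊨-respʳ-≼ v (▸-≼ʳ v inj₁ (inj₂ refl) (≤.reflexive (sym eq))) (e v adm)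

    module _ (_∨_ : Formula → Formula → Formula)
             (≤∨ˡ : ∀ v A B → eval v A ≤ eval v (A ∨ B))
             (≤∨ʳ : ∀ v A B → eval v B ≤ eval v (A ∨ B))
             (∨-sel : ∀ v A B → eval v (A ∨ B) ≡ eval v A ⊎ eval v (A ∨ B) ≡ eval v B)
             where

      -- The order dual: the bound gives `right⁻` and `left⁺`, selectivity gives `right⁺` and
      -- `left⁻`.
      selective-upper-bound⇒GDisjunction : IsGDisjunction _∨_
      selective-upper-bound⇒GDisjunction Γ Δ A B = mk⇔ right⁺ right⁻ , mk⇔ left⁺ left⁻
        where
        right⁺ : Γ ⊢ Δ ▸ (A ∨ B) → Γ ⊢ Δ ▸ A ▸ B
        right⁺ d v adm with ∨-sel v A B
        ... | inj₁ eq = ⊨-respʳ-≼ v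
          (▸-≼ʳ v (inj₁ ∘ inj₁) (inj₁ (inj₂ refl)) (≤.reflexive eq)) (d v adm)
        ... | inj₂ eq = ⊨-respʳ-≼ v
          (▸-≼ʳ v (inj₁ ∘ inj₁) (inj₂ refl) (≤.reflexive eq)) (d v adm)

        right⁻ : Γ ⊢ Δ ▸ A ▸ B → Γ ⊢ Δ ▸ (A ∨ B)
        right⁻ d v adm = ⊨-respʳ-≼ v r (d v adm)
          where
          r : _≼ʳ_ v (Δ ▸ A ▸ B) (Δ ▸ (A ∨ B))
          r (inj₁ C∈)   = ▸-≼ʳ v inj₁ (inj₂ refl) (≤∨ˡ v A B) C∈
          r (inj₂ refl) = _ , inj₂ refl , ≤∨ʳ v A B

        left⁺ : Γ ▸ (A ∨ B) ⊢ Δ → Γ ▸ A ⊢ Δ × Γ ▸ B ⊢ Δ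
        left⁺ d =
          (λ v adm → ⊨-respˡ-≼ v (▸-≼ˡ v inj₁ (inj₂ refl) (≤∨ˡ v A B)) (d v adm)) ,
          (λ v adm → ⊨-respˡ-≼ v (▸-≼ˡ v inj₁ (inj₂ refl) (≤∨ʳ v A B)) (d v adm))

        left⁻ : Γ ▸ A ⊢ Δ × Γ ▸ B ⊢ Δ → Γ ▸ (A ∨ B) ⊢ Δ
        left⁻ (d , e) v adm with ∨-sel v A B
        ... | inj₁ eq = ⊨-respˡ-≼ v
          (▸-≼ˡ v inj₁ (inj₂ refl) (≤.reflexive eq)) (d v adm)
        ... | inj₂ eq = ⊨-respˡ-≼ v
          (▸-≼ˡ v inj₁ (inj₂ refl) (≤.reflexive eq)) (e v adm)

    -- Consequences of the G-rules at a generic valuation.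

    module _ (generic : HasGenericValuation S) where

      private
        v    = proj₁ generic
        adm  = proj₁ (proj₂ generic)
        onto = proj₂ (proj₂ generic)

      no-GNegation : ∀ {h} → h ≢ 𝟘 → h ≢ 𝟙 → ∀ neg → ¬ IsGNegation neg
      no-GNegation {h} h≢𝟘 h≢𝟙 neg rules with onto h
      ... | A , refl = ≢𝟘⇒𝟙≢𝟘 h≢𝟘 (trans (sym ¬h≡𝟙) ¬h≡𝟘)
        where
        ¬h≡𝟘 : eval v (neg A) ≡ 𝟘
        -- `A ⊢ A` becomes `A, neg A ⊢`. Without conclusions, only a premise of value `𝟘` can
        -- satisfy the relation.
        ¬h≡𝟘 with from (proj₁ (rules (∅ ▸ A) ∅ A)) (shared (inj₂ refl) (inj₂ refl)) v adm
        ... | inj₂ (inj₁ (_ , inj₁ (inj₂ refl) , eq)) = contradiction eq h≢𝟘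
        ... | inj₂ (inj₁ (_ , inj₂ refl , eq))        = eq

        ¬h≡𝟙 : eval v (neg A) ≡ 𝟙
        -- Dually, `⊢ A, neg A` has no premises, so some conclusion has value `𝟙`.
        ¬h≡𝟙 with from (proj₂ (rules ∅ (∅ ▸ A) A)) (shared (inj₂ refl) (inj₂ refl)) v adm
        ... | inj₂ (inj₂ (_ , inj₁ (inj₂ refl) , eq)) = contradiction eq h≢𝟙
        ... | inj₂ (inj₂ (_ , inj₂ refl , eq))        = eq

      no-GConditional : ∀ {h} → h ≢ 𝟘 → h ≢ 𝟙 → ∀ _⊃_ → ¬ IsGConditional _⊃_
      no-GConditional {h} h≢𝟘 h≢𝟙 _⊃_ rules with onto h | onto 𝟘
      ... | A , refl | B , B≡𝟘 = absurd
        where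
        𝟙≢𝟘 : 𝟙 ≢ 𝟘
        𝟙≢𝟘 = ≢𝟘⇒𝟙≢𝟘 h≢𝟘

        A⊃B≡𝟙 : eval v (A ⊃ B) ≡ 𝟙
        -- `A ⊢ A, B` becomes `⊢ A, A ⊃ B`, where `A` does not have value `𝟙`.
        A⊃B≡𝟙 with from (proj₁ (rules ∅ (∅ ▸ A) A B))
                        (shared (inj₂ refl) (inj₁ (inj₂ refl))) v adm
        ... | inj₂ (inj₂ (_ , inj₁ (inj₂ refl) , eq)) = contradiction eq h≢𝟙
        ... | inj₂ (inj₂ (_ , inj₂ refl , eq))        = eq

        ≤B⇒≡𝟘 : ∀ {x} → x ≤ eval v B → x ≡ 𝟘
        ≤B⇒≡𝟘 x≤B = ≤𝟘⇒≡𝟘 (subst (_ ≤_) B≡𝟘 x≤B)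

        absurd : ⊥
        -- `A ⊢ B, A` and `A, B ⊢ B` yield modus ponens, `A, A ⊃ B ⊢ B`. At `v` the premises have
        -- values `h` and `𝟙` and the conclusion has value `𝟘`, so every clause fails.
        absurd with from (proj₂ (rules (∅ ▸ A) (∅ ▸ B) A B))
                         (shared (inj₂ refl) (inj₂ refl) , shared (inj₂ refl) (inj₂ refl)) v adm
        ... | inj₁ (_ , _ , (_ , inj₁ (inj₂ refl) , refl) , (_ , inj₂ refl , refl) , le) =
          h≢𝟘 (≤B⇒≡𝟘 le)
        ... | inj₁ (_ , _ , (_ , inj₂ refl , refl) , (_ , inj₂ refl , refl) , le) =
          𝟙≢𝟘 (trans (sym A⊃B≡𝟙) (≤B⇒≡𝟘 le))
        ... | inj₂ (inj₁ (_ , inj₁ (inj₂ refl) , eq)) = h≢𝟘 eq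
        ... | inj₂ (inj₁ (_ , inj₂ refl , eq))        = 𝟙≢𝟘 (trans (sym A⊃B≡𝟙) eq)
        ... | inj₂ (inj₂ (_ , inj₂ refl , eq))        = 𝟙≢𝟘 (trans (sym eq) B≡𝟘)

      GConjunction⇒totalOffBounds : ∀ _∧_ → IsGConjunction _∧_ → TotalOffBounds _≤_ 𝟘 𝟙
      GConjunction⇒totalOffBounds _∧_ rules x y x≢𝟘 x≢𝟙 y≢𝟘 y≢𝟙 with onto x | onto y
      ... | A , refl | B , refl = comparable
        where
        -- `A, B ⊢ C` becomes `A ∧ B ⊢ C`. A premise of value `𝟘` still gives the inequality, and
        -- `C≢𝟙` excludes the remaining clause.
        A∧B≤ : ∀ C → C ∈ ∅ ▸ A ▸ B → eval v C ≢ 𝟙 → eval v (A ∧ B) ≤ eval v C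
        A∧B≤ C C∈ C≢𝟙 with from (proj₁ (rules ∅ (∅ ▸ C) A B)) (shared C∈ (inj₂ refl)) v adm
        ... | inj₁ (_ , _ , (_ , inj₂ refl , refl) , (_ , inj₂ refl , refl) , le) = le
        ... | inj₂ (inj₁ (_ , inj₂ refl , eq)) = subst (_≤ _) (sym eq) (𝟘-min _)
        ... | inj₂ (inj₂ (_ , inj₂ refl , eq)) = contradiction eq C≢𝟙

        ∧≤A : eval v (A ∧ B) ≤ eval v A
        ∧≤A = A∧B≤ A (inj₁ (inj₂ refl)) x≢𝟙

        ∧≤B : eval v (A ∧ B) ≤ eval v B
        ∧≤B = A∧B≤ B (inj₂ refl) y≢𝟙

        comparable : eval v A ≤ eval v B ⊎ eval v B ≤ eval v A
        -- `A, B ⊢ A` and `A, B ⊢ B` combine to `A, B ⊢ A ∧ B`. One argument thus lies below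
        -- `A ∧ B`, hence below the other; if `A ∧ B` had value `𝟙`, so would `A`.
        comparable with from (proj₂ (rules (∅ ▸ A ▸ B) ∅ A B))
                             (shared (inj₁ (inj₂ refl)) (inj₂ refl) ,
                              shared {A = B} (inj₂ refl) (inj₂ refl)) v adm
        ... | inj₁ (_ , _ , (_ , inj₁ (inj₂ refl) , refl) , (_ , inj₂ refl , refl) , le) =
          inj₁ (≤.trans le ∧≤B)
        ... | inj₁ (_ , _ , (_ , inj₂ refl , refl) , (_ , inj₂ refl , refl) , le) =
          inj₂ (≤.trans le ∧≤A)
        ... | inj₂ (inj₁ (_ , inj₁ (inj₂ refl) , eq)) = contradiction eq x≢𝟘
        ... | inj₂ (inj₁ (_ , inj₂ refl , eq))        = contradiction eq y≢𝟘
        ... | inj₂ (inj₂ (_ , inj₂ refl , eq))        =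
          contradiction (𝟙≤⇒≡𝟙 (subst (_≤ _) eq ∧≤A)) x≢𝟙

  -- Minimum and maximum on a chain.

  totalOffBounds⇒total : DecidableEquality V → TotalOffBounds _≤_ 𝟘 𝟙 → Total _≤_
  -- A bound is comparable with everything, so only a pair that fails all four tests needs `total`.
  totalOffBounds⇒total _≟_ total x y with x ≟ 𝟘 | x ≟ 𝟙 | y ≟ 𝟘 | y ≟ 𝟙
  ... | yes refl | _        | _        | _        = inj₁ (𝟘-min y)
  ... | no _     | yes refl | _        | _        = inj₂ (𝟙-max y)
  ... | no _     | no _     | yes refl | _        = inj₂ (𝟘-min x)
  ... | no _     | no _     | no _     | yes refl = inj₁ (𝟙-max x)
  ... | no x≢𝟘   | no x≢𝟙   | no y≢𝟘   | no y≢𝟙   = total x y x≢𝟘 x≢𝟙 y≢𝟘 y≢𝟙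

  module _ (S : Semantics V) (total : Total _≤_) where

    private
      totalOrder : TotalOrder 0ℓ 0ℓ 0ℓ
      totalOrder = record { isTotalOrder = record { isPartialOrder = po ; total = total } }

      open Min totalOrder using (_⊓_; ⊓-sel; x⊓y≤x; x⊓y≤y)
      open Max totalOrder using (_⊔_; ⊔-sel; x≤x⊔y; x≤y⊔x)

    -- A formula built with the new connective evaluates by computation to `_⊓_` of the values of
    -- its arguments, so the laws of minimum apply directly.
    total⇒GConjunction : AdmitsGConjunction S _⊨_
    total⇒GConjunction = (λ { (x ∷ y ∷ []) → x ⊓ y }) ,
      selective-lower-bound⇒GConjunction _ _
        (λ _ _ _ → x⊓y≤x _ _) (λ _ _ _ → x⊓y≤y _ _) (λ _ _ _ → ⊓-sel _ _)

    total⇒GDisjunction : AdmitsGDisjunction S _⊨_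
    total⇒GDisjunction = (λ { (x ∷ y ∷ []) → x ⊔ y }) ,
      selective-upper-bound⇒GDisjunction _ _
        (λ _ _ _ → x≤x⊔y _ _) (λ _ _ _ → x≤y⊔x _ _) (λ _ _ _ → ⊔-sel _ _)

theorem6p7 : ∀ (N : ℕ) → 3 ≤ℕ N → (V : Set) → V ↔ Fin N →
    (_≤_ : Rel V 0ℓ) → IsPartialOrder _≡_ _≤_ →
    (𝟘 𝟙 : V) → Minimum _≤_ 𝟘 → Maximum _≤_ 𝟙 →
    (S : Semantics V) → AtomicExpressive S →
    let _⊨_ = OrderTruthRelation _≤_ 𝟘 𝟙 in
    ¬ AdmitsGNegation S _⊨_ ×
    ¬ AdmitsGConditional S _⊨_ ×
    ((AdmitsGConjunction S _⊨_ × AdmitsGDisjunction S _⊨_) ⇔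
    TotalOffBounds _≤_ 𝟘 𝟙)
theorem6p7 N 3≤N V V↔Fin _≤_ po 𝟘 𝟙 𝟘-min 𝟙-max S expressive =
  (λ (f , rules) →
    no-GNegation po 𝟘-min 𝟙-max (extend S 1 f) (generic⁺ 1 f) h≢𝟘 h≢𝟙 _ rules) ,
  (λ (f , rules) →
    no-GConditional po 𝟘-min 𝟙-max (extend S 2 f) (generic⁺ 2 f) h≢𝟘 h≢𝟙 _ rules) ,
  mk⇔
    (λ ((f , rules) , _) →
      GConjunction⇒totalOffBounds po 𝟘-min 𝟙-max (extend S 2 f) (generic⁺ 2 f) _ rules)
    (λ totalOff →
      -- Equality of truth values is decided by comparing their indices in `Fin N`.
      let total = totalOffBounds⇒total po 𝟘-min 𝟙-max (inj⇒≟ (↔⇒↣ V↔Fin)) totalOff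
      in total⇒GConjunction po 𝟘-min 𝟙-max S total , total⇒GDisjunction po 𝟘-min 𝟙-max S total)
  where
  generic⁺ : ∀ n f → HasGenericValuation (extend S n f)
  generic⁺ n f = generic-extend S n f (atomicExpressive⇒generic S expressive)

  open Inverse V↔Fin using () renaming (to to index; from to value; strictlyInverseˡ to index∘value)

  -- The bound `3 ≤ℕ N` supplies the index of a value strictly between the bounds, on which both
  -- refutations rest.
  third : ∃ λ k → k ≢ index 𝟘 × k ≢ index 𝟙
  third = avoid-two 3≤N (index 𝟘) (index 𝟙)

  h : V
  h = value (proj₁ third)

  h≢𝟘 : h ≢ 𝟘
  h≢𝟘 eq = proj₁ (proj₂ third) (trans (sym (index∘value _)) (cong index eq))

  h≢𝟙 : h ≢ 𝟙
  h≢𝟙 eq = proj₂ (proj₂ third) (trans (sym (index∘value _)) (cong index eq))
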